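{- Let $m=5$, $t=3$, and let $n,\lambda$ be positive integers with $5\le\lambda\le\frac{n(n-1)}{2}$. \begin{enumerate} \item[(a)] If $\mu(\lambda,5;3)\ge n-1$ and $2\lambda\ge 4n$, then there exists a $(3+1)$-color connected colored edge graph $G(V,E,C,f)$ with $|V|=n$, $|E|=\lambda$, $|C|=5$. \item[(b)] Suppose $2\lambda\ge 4n$, and suppose that: if $n=2k$ for some integer $k>0$ then $\lambda\ge 5k-1$; and if $n=2k+1$ for some integer $k>0$ then $\lambda\ge 5k$. Then there exists a $(3+1)$-color connected colored edge graph $G(V,E,C,f)$ with $|V|=n$, $|E|=\lambda$, $|C|=5$. \end{enumerate}
   Context: All graphs are finite, undirected and simple (no loops, no multiple edges). A colored edge graph is a tuple $G(V,E,C,f)$ where $(V,E)$ is a graph with node set $V$ and edge set $E$, $C$ is a finite set of colors, and $f:E\to C$ is a surjective map. For an integer $t\ge 1$, two distinct nodes $A,B\in V$ are $(t+1)$-color connected if for every color set $C_t\subseteq C$ with $|C_t|=t$ there is a path from $A$ to $B$ in $G$ none of whose edges has a color in $C_t$. The colored edge graph $G$ is $(t+1)$-color connected if every two distinct nodes of $G$ are $(t+1)$-color connected. A $(\lambda,m)$-partition is a pair $(X,\mathcal{F})$ where $X$ is a finite set with $|X|=\lambda$ and $\mathcal{F}$ is a set of mutually disjoint subsets of $X$ with $|\mathcal{F}|=m$ and $X=\bigcup_{P\in\mathcal{F}}P$. For $1\le t\le m$ put $\mu(X,\mathcal{F};t)=\min\{|X\setminus(B_1\cup\cdots\cup B_t)|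 : B_1,\ldots,B_t \text{ distinct elements of } \mathcal{F}\}$, and $\mu(\lambda,m;t)=\max\{\mu(X,\mathcal{F};t): (X,\mathcal{F})\text{ is a }(\lambda,m)\text{ -partition}\}$. -}

module Defs where

open import Data.Bool.Properties using () renaming (_≟_ to _≟ᵇ_)
open import Data.Fin using (Fin)
open import Data.Fin.Subset using (Subset; inside; outside; _∉_; _∩_; ∁; ⋃; ⊤; Empty; ∣_∣)
open import Data.Fin.Subset.Properties using (nonempty?)
open import Data.List as List using (List; []; _∷_)
open import Data.List.Extrema.Nat using (min; max)
open import Data.List.Relation.Unary.All using (All)
open import Data.List.Relation.Unary.Unique.Propositional using (Unique)
open import Data.Nat using (ℕ; zero; suc)
open import Data.Product using (_×_; _,_; proj₁; proj₂; Σ-syntax)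
open import Data.Sum using (_⊎_)
open import Data.Vec as Vec using (Vec; toList)
import Data.Vec.Properties as Vecₚ
open import Data.Vec.Relation.Unary.AllPairs using (AllPairs; allPairs?)
import Data.Vec.Relation.Unary.Unique.Propositional as Vecᵤ
open import Function.Definitions using (Surjective)
open import Relation.Binary.Definitions using (DecidableEquality)
open import Relation.Binary.PropositionalEquality using (_≡_; _≢_)
open import Relation.Nullary.Decidable using (Dec; ¬?; _×-dec_)

-- Finite sets with n elements are represented by Fin n throughout.

-- A finite simple undirected graph with n nodes and ℓ edges.  The order in
-- which `ends` lists the two end nodes of an edge carries no meaning: edges
-- are only ever used through the symmetric relation Joins.  No two edges join
-- the same nodes, so the edges form a set of two-element sets of nodes.

record Graph (n ℓ : ℕ) : Set where
  field
    ends : Fin ℓ → Fin n × Fin n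

  Joins : Fin ℓ → Fin n → Fin n → Set
  Joins e x y = ends e ≡ (x , y) ⊎ ends e ≡ (y , x)

  field
    loopless   : ∀ e → proj₁ (ends e) ≢ proj₂ (ends e)
    unrepeated : ∀ {e e′ x y} → Joins e x y → Joins e′ x y → e ≡ e′

  data Walk : Fin n → Fin n → Set where
    nil  : ∀ {x} → Walk x x
    cons : ∀ {x y z} (e : Fin ℓ) → Joins e x y → Walk y z → Walk x z

  nodes : ∀ {x y} → Walk x y → List (Fin n)
  nodes {x} nil          = x ∷ []
  nodes {x} (cons _ _ w) = x ∷ nodes w

  edges : ∀ {x y} → Walk x y → List (Fin ℓ)
  edges nil          = []
  edges (cons e _ w) = e ∷ edges w

  IsPath : ∀ {x y} → Walk x y → Set
  IsPath w = Unique (nodes w)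

record ColoredEdgeGraph (n ℓ c : ℕ) : Set where
  field
    graph            : Graph n ℓ
    color            : Fin ℓ → Fin c
    color-surjective : Surjective _≡_ _≡_ color

  open Graph graph public

-- (t + 1)-color connectedness: t is the number of colors removed.

ColorConnectedNodes : ∀ {n ℓ c} → ℕ → ColoredEdgeGraph n ℓ c → Fin n → Fin n → Set
ColorConnectedNodes {c = c} t G A B =
  (Cₜ : Subset c) → ∣ Cₜ ∣ ≡ t →
  Σ[ w ∈ Walk A B ] IsPath w × All (λ e → color e ∉ Cₜ) (edges w)
  where open ColoredEdgeGraph G

[_+1]-ColorConnected : ∀ {n ℓ c} → ℕ → ColoredEdgeGraph n ℓ c → Set
[ t +1]-ColorConnected G = ∀ A B → A ≢ B → ColorConnectedNodes t G A B

-- The (λ,m)-partitions, written with ℓ for λ, which is a reserved symbol.  The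
-- set of blocks is listed without repetition, its m members being subsets of
-- Fin ℓ.  A block may be
-- empty, but distinctness allows at most one such block.

Distinct : ∀ {ℓ k} → Vec (Subset ℓ) k → Set
Distinct = Vecᵤ.Unique

IsPartition : ∀ {ℓ m} → Vec (Subset ℓ) m → Set
IsPartition F =
  Distinct F × AllPairs (λ P Q → Empty (P ∩ Q)) F × ⋃ (toList F) ≡ ⊤

_≟ˢ_ : ∀ {ℓ} → DecidableEquality (Subset ℓ)
_≟ˢ_ = Vecₚ.≡-dec _≟ᵇ_

distinct? : ∀ {ℓ k} (B : Vec (Subset ℓ) k) → Dec (Distinct B)
distinct? = allPairs? (λ P Q → ¬? (P ≟ˢ Q))

isPartition? : ∀ {ℓ m} (F : Vec (Subset ℓ) m) → Dec (IsPartition F)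
isPartition? F =
  distinct? F
  ×-dec allPairs? (λ P Q → ¬? (nonempty? (P ∩ Q))) F
  ×-dec (⋃ (toList F) ≟ˢ ⊤)

-- All vectors of length k with entries from the given list.

vectors : ∀ {A : Set} (k : ℕ) → List A → List (Vec A k)
vectors zero    xs = Vec.[] ∷ []
vectors (suc k) xs = List.cartesianProductWith Vec._∷_ xs (vectors k xs)

subsets : ∀ ℓ → List (Subset ℓ)
subsets ℓ = vectors ℓ (outside ∷ inside ∷ [])

partitions : ∀ ℓ m → List (Vec (Subset ℓ) m)
partitions ℓ m = List.filter isPartition? (vectors m (subsets ℓ))

-- μ(X,F;t).  The first argument of min is returned on the empty list only when
-- t > m; otherwise it has no effect, since |X \ (B₁ ∪ ⋯ ∪ Bₜ)| ≤ |X| = ℓ.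

μ-of : ∀ {ℓ m} → Vec (Subset ℓ) m → ℕ → ℕ
μ-of {ℓ} F t =
  min ℓ (List.map (λ B → ∣ ∁ (⋃ (toList B)) ∣)
                  (List.filter distinct? (vectors t (toList F))))

-- μ(λ,m;t).  The first argument 0 of max is the least natural number, so it
-- has no effect as long as a partition exists.

μ : ℕ → ℕ → ℕ → ℕ
μ ℓ m t = max 0 (List.map (λ F → μ-of F t) (partitions ℓ m))

{-# OPTIONS --safe #-}

-- Removing three of five colors leaves at least two, so it suffices that the
-- union of any two color classes is connected.  For n = 2m + 1 take nodes
-- u₀, v₀, …, u₍ₘ₋₁₎, v₍ₘ₋₁₎ and w, with the edges
--   A : uᵢ uᵢ₊₁ and v₀ w        B : vᵢ vᵢ₊₁ and u₀ w        C : uᵢ vᵢ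
--   D : uᵢ vᵢ₊₁ and u₍ₘ₋₁₎ w    E : vᵢ uᵢ₊₁ and v₍ₘ₋₁₎ w
-- Each color has m edges, 5m in all.  Before w is added, two colors including C
-- already span a connected graph, and any other two form exactly two components,
-- which w joins.  For n = 2m + 2 one more node with four edges, in the colors other
-- than C, gives 5(m + 1) − 1 edges.  Further edges may have any color.
--
-- For (a), if μ(λ, 5; 3) ≥ n − 1 then some partition has any two blocks of total
-- size at least n − 1, and adding up sizes yields the bounds assumed in (b).

module Submission where

open import Defs
open import Data.Fin as Fin using (Fin; zero; suc; toℕ; fromℕ<)
import Data.Fin.Properties as Finₚ
open import Data.Fin.Subset
  using (Subset; inside; outside; _∈_; _∉_; _∩_; _∪_; ∁; ⋃; ⊤; Empty; ∣_∣)
open import Data.Fin.Subset.Properties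
  using (∉⊥; ∈⊤; x∈p∪q⁺; x∈p∪q⁻; x∈p∩q⁺; x∈p∩q⁻; x∈∁p⇒x∉p; p⊆q⇒∣p∣≤∣q∣; ∣⊤∣≡n; _∈?_; anySubset?)
open import Data.List as List using (List; []; _∷_; _++_; length; upTo; filter; take)
open import Data.List.Extrema.Nat using (max<v⁺; min≤v⁺)
import Data.List.Membership.DecPropositional as DecMem
open import Data.List.Membership.Propositional using () renaming (_∈_ to _∈ᴸ_)
import Data.List.Membership.Propositional.Properties as Listₘ
import Data.List.Properties as Listₚ
open import Data.List.Relation.Unary.All as All using (All; []; _∷_)
import Data.List.Relation.Unary.All.Properties as Allₚ
open import Data.List.Relation.Unary.AllPairs using ([]; _∷_)
open import Data.List.Relation.Unary.Any as Any using (Any; here; there)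
import Data.List.Relation.Unary.Any.Properties as Anyₚ
open import Data.List.Relation.Unary.Unique.Propositional using (Unique)
import Data.List.Relation.Unary.Unique.Propositional.Properties as Uniqueₚ
open import Data.Nat
open import Data.Nat.DivMod using (m*n/n≡m)
open import Data.Nat.Properties
open import Data.Nat.Tactic.RingSolver using (solve-∀)
open import Data.Product using (_×_; _,_; proj₁; proj₂; Σ-syntax; ∃-syntax)
open import Data.Product.Properties using (,-injective; ≡-dec)
open import Data.Sum as Sum using (_⊎_; inj₁; inj₂; [_,_]′)
open import Data.Vec as Vec using (Vec; []; _∷_; lookup; toList)
import Data.Vec.Membership.Propositional.Properties as Vecₘ
import Data.Vec.Properties as Vecₚ
import Data.Vec.Relation.Unary.All.Properties as VecAllₚ
open import Data.Vec.Relation.Unary.AllPairs using (AllPairs; []; _∷_)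
import Data.Vec.Relation.Unary.Unique.Propositional.Properties as Vecᵤₚ
open import Function using (_∘_; id)
open import Relation.Binary.Construct.Closure.Equivalence as EqC using (EqClosure)
open import Relation.Binary.Construct.Closure.ReflexiveTransitive using (ε; _◅_; _◅◅_)
open import Relation.Binary.Construct.Closure.Symmetric using (fwd; bwd)
open import Relation.Binary.PropositionalEquality
open import Relation.Nullary using (Dec; yes; no; ¬_; contradiction)
open import Relation.Nullary.Decidable using (¬?; _×-dec_; toWitnessFalse; decidable-stable)

open import Algebra.Properties.CommutativeMonoid.Sum +-0-commutativeMonoid using (sum; sum-remove)

-- Block sizes

x∈⋃⁺ : ∀ {ℓ m x} (F : Vec (Subset ℓ) m) i → x ∈ lookup F i → x ∈ ⋃ (toList F)
x∈⋃⁺ (P ∷ F) zero    x∈ = x∈p∪q⁺ (inj₁ x∈)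
x∈⋃⁺ (P ∷ F) (suc i) x∈ = x∈p∪q⁺ (inj₂ (x∈⋃⁺ F i x∈))

x∈⋃⁻ : ∀ {ℓ m x} (F : Vec (Subset ℓ) m) → x ∈ ⋃ (toList F) → ∃[ i ] x ∈ lookup F i
x∈⋃⁻ []      x∈ = contradiction x∈ ∉⊥
x∈⋃⁻ (P ∷ F) x∈ with x∈p∪q⁻ P (⋃ (toList F)) x∈
... | inj₁ x∈P = zero , x∈P
... | inj₂ x∈⋃ with i , x∈Fᵢ ← x∈⋃⁻ F x∈⋃ = suc i , x∈Fᵢ

∣p∪q∣≤∣p∣+∣q∣ : ∀ {n} (p q : Subset n) → ∣ p ∪ q ∣ ≤ ∣ p ∣ + ∣ q ∣
∣p∪q∣≤∣p∣+∣q∣ []            []            = z≤n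
∣p∪q∣≤∣p∣+∣q∣ (outside ∷ p) (outside ∷ q) = ∣p∪q∣≤∣p∣+∣q∣ p q
∣p∪q∣≤∣p∣+∣q∣ (outside ∷ p) (inside  ∷ q)
  rewrite +-suc ∣ p ∣ ∣ q ∣ = s≤s (∣p∪q∣≤∣p∣+∣q∣ p q)
∣p∪q∣≤∣p∣+∣q∣ (inside  ∷ p) (outside ∷ q) = s≤s (∣p∪q∣≤∣p∣+∣q∣ p q)
∣p∪q∣≤∣p∣+∣q∣ (inside  ∷ p) (inside  ∷ q)
  rewrite +-suc ∣ p ∣ ∣ q ∣ = s≤s (m≤n⇒m≤1+n (∣p∪q∣≤∣p∣+∣q∣ p q))

Empty-tail : ∀ {n s} {p : Subset n} → Empty (s ∷ p) → Empty p
Empty-tail empty (x , x∈) = empty (suc x , Vec.there x∈)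

disjoint⇒∣p∣+∣q∣≤∣p∪q∣ : ∀ {n} (p q : Subset n) → Empty (p ∩ q) → ∣ p ∣ + ∣ q ∣ ≤ ∣ p ∪ q ∣
disjoint⇒∣p∣+∣q∣≤∣p∪q∣ []            []            _ = z≤n
disjoint⇒∣p∣+∣q∣≤∣p∪q∣ (outside ∷ p) (outside ∷ q) e =
  disjoint⇒∣p∣+∣q∣≤∣p∪q∣ p q (Empty-tail e)
disjoint⇒∣p∣+∣q∣≤∣p∪q∣ (outside ∷ p) (inside  ∷ q) e
  rewrite +-suc ∣ p ∣ ∣ q ∣ = s≤s (disjoint⇒∣p∣+∣q∣≤∣p∪q∣ p q (Empty-tail e))
disjoint⇒∣p∣+∣q∣≤∣p∪q∣ (inside  ∷ p) (outside ∷ q) e =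
  s≤s (disjoint⇒∣p∣+∣q∣≤∣p∪q∣ p q (Empty-tail e))
disjoint⇒∣p∣+∣q∣≤∣p∪q∣ (inside  ∷ p) (inside  ∷ q) e =
  contradiction (zero , Vec.here) e

sum-∣blocks∣≤∣⋃∣ : ∀ {ℓ m} (F : Vec (Subset ℓ) m) → AllPairs (λ P Q → Empty (P ∩ Q)) F →
                   sum (λ i → ∣ lookup F i ∣) ≤ ∣ ⋃ (toList F) ∣
sum-∣blocks∣≤∣⋃∣ []      []           = z≤n
sum-∣blocks∣≤∣⋃∣ (P ∷ F) (P# ∷ F#) = begin
  ∣ P ∣ + sum (λ i → ∣ lookup F i ∣) ≤⟨ +-monoʳ-≤ ∣ P ∣ (sum-∣blocks∣≤∣⋃∣ F F#) ⟩
  ∣ P ∣ + ∣ ⋃ (toList F) ∣           ≤⟨ disjoint⇒∣p∣+∣q∣≤∣p∪q∣ P (⋃ (toList F)) P#⋃ ⟩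
  ∣ P ∪ ⋃ (toList F) ∣               ∎
  where
  open ≤-Reasoning
  P#⋃ : Empty (P ∩ ⋃ (toList F))
  P#⋃ (x , x∈) with x∈P , x∈⋃ ← x∈p∩q⁻ P _ x∈ with i , x∈Fᵢ ← x∈⋃⁻ F x∈⋃ =
    VecAllₚ.lookup⁺ P# i (x , x∈p∩q⁺ (x∈P , x∈Fᵢ))

∈-vectors : ∀ {A : Set} {k} {xs : List A} (B : Vec A k) →
            (∀ i → lookup B i ∈ᴸ xs) → B ∈ᴸ vectors k xs
∈-vectors []      _  = here refl
∈-vectors (b ∷ B) ∈xs =
  Listₘ.∈-cartesianProductWith⁺ Vec._∷_ (∈xs zero) (∈-vectors B (∈xs ∘ suc))

μ-of-≤ : ∀ {ℓ m k} (F : Vec (Subset ℓ) m) (B : Vec (Subset ℓ) k) → Distinct B →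
         (∀ i → lookup B i ∈ᴸ toList F) → μ-of F k ≤ ∣ ∁ (⋃ (toList B)) ∣
μ-of-≤ {ℓ} {k = k} F B B! B⊆F =
  min≤v⁺ ℓ _ (inj₂ (Any.map (≤-reflexive ∘ sym)
    (Listₘ.∈-map⁺ (λ B → ∣ ∁ (⋃ (toList B)) ∣)
      (Listₘ.∈-filter⁺ distinct? (∈-vectors B B⊆F) B!))))

-- Removing the m blocks other than those at p and q is one of the choices in the minimum, and what
-- it leaves over lies in these two blocks.
μ-of-≤-two-blocks : ∀ {ℓ m} (F : Vec (Subset ℓ) (2 + m)) → IsPartition F → ∀ {p q} → p ≢ q →
                    μ-of F m ≤ ∣ lookup F p ∣ + ∣ lookup F q ∣
μ-of-≤-two-blocks {m = m} F (F! , _ , ⋃F≡⊤) {p} {q} p≢q = begin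
  μ-of F m                               ≤⟨ μ-of-≤ F B B! B⊆F ⟩
  ∣ ∁ (⋃ (toList B)) ∣                   ≤⟨ p⊆q⇒∣p∣≤∣q∣ rest⊆ ⟩
  ∣ lookup F p ∪ lookup F q ∣            ≤⟨ ∣p∪q∣≤∣p∣+∣q∣ (lookup F p) (lookup F q) ⟩
  ∣ lookup F p ∣ + ∣ lookup F q ∣        ∎
  where
  open ≤-Reasoning
  -- An enumeration of the indices other than p and q: `Fin.punchOut p≢q` is the position of q once
  -- p has been deleted.
  skip : Fin m → Fin (2 + m)
  skip a = Fin.punchIn p (Fin.punchIn (Fin.punchOut p≢q) a)
  skip-surjective : ∀ {x} → p ≢ x → q ≢ x → ∃[ a ] skip a ≡ x
  skip-surjective {x} p≢x q≢x =
    Fin.punchOut q≢x′ ,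
    trans (cong (Fin.punchIn p) (Finₚ.punchIn-punchOut q≢x′)) (Finₚ.punchIn-punchOut p≢x)
    where
    q≢x′ : Fin.punchOut p≢q ≢ Fin.punchOut p≢x
    q≢x′ = q≢x ∘ Finₚ.punchOut-injective p≢q p≢x
  B = Vec.tabulate (lookup F ∘ skip)
  lookup-B : ∀ a → lookup B a ≡ lookup F (skip a)
  lookup-B = Vecₚ.lookup∘tabulate (lookup F ∘ skip)
  B! : Distinct B
  B! = Vecᵤₚ.tabulate⁺ λ eq → Finₚ.punchIn-injective _ _ _
    (Finₚ.punchIn-injective p _ _ (Vecᵤₚ.lookup-injective F! _ _ eq))
  B⊆F : ∀ a → lookup B a ∈ᴸ toList F
  B⊆F a rewrite lookup-B a = Vecₘ.∈-toList⁺ (Vecₘ.∈-lookup (skip a) F)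
  rest⊆ : ∀ {x} → x ∈ ∁ (⋃ (toList B)) → x ∈ lookup F p ∪ lookup F q
  rest⊆ {x} x∈ with y , x∈F ← x∈⋃⁻ F (subst (x ∈_) (sym ⋃F≡⊤) ∈⊤) with p Fin.≟ y | q Fin.≟ y
  ... | yes refl | _        = x∈p∪q⁺ (inj₁ x∈F)
  ... | no _     | yes refl = x∈p∪q⁺ (inj₂ x∈F)
  ... | no p≢y   | no q≢y with a , refl ← skip-surjective p≢y q≢y =
    contradiction (x∈⋃⁺ B a (subst (x ∈_) (sym (lookup-B a)) x∈F)) (x∈∁p⇒x∉p x∈)

-- Lower bound on λ from μ(λ, 5; 3)

sum-lower : ∀ {m} (s : Fin m → ℕ) {c r} → (∀ i → c ≤ s i + r) → m * c ≤ sum s + m * r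
sum-lower {zero}  s             c≤ = z≤n
sum-lower {suc m} s {c} {r} c≤ = begin
  c + m * c                                ≤⟨ +-mono-≤ (c≤ zero) (sum-lower (s ∘ suc) (c≤ ∘ suc)) ⟩
  s zero + r + (sum (s ∘ suc) + m * r)     ≡⟨ lem (s zero) r (sum (s ∘ suc)) (m * r) ⟩
  s zero + sum (s ∘ suc) + (r + m * r)     ∎
  where
  open ≤-Reasoning
  lem : ∀ a b c d → a + b + (c + d) ≡ a + c + (b + d)
  lem = solve-∀

-- Averaging over the ten pairs would lose 5r/2 instead of r. The proof therefore uses integrality:
-- either all terms are at least K, or one term below K is outweighed by the other four.
five-sum-lower : ∀ (s : Fin 5 → ℕ) {K r} → r ≤ 1 →
                 (∀ {p q} → p ≢ q → 2 * K ≤ s p + s q + r) → 5 * K ≤ sum s + r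
five-sum-lower s {K} {r} r≤1 pairs with Finₚ.any? (λ i → s i <? K)
... | no ∄small = begin
  5 * K            ≤⟨ sum-lower s (λ i → m≤n⇒m≤n+o 0 (≮⇒≥ (λ sᵢ<K → ∄small (i , sᵢ<K)))) ⟩
  sum s + 5 * 0    ≤⟨ +-monoʳ-≤ (sum s) z≤n ⟩
  sum s + r        ∎
  where open ≤-Reasoning
-- A term K − 1 − δ forces each of the others up to at least K + 1 + δ − r.
... | yes (i , sᵢ<K) with δ , refl ← m≤n⇒∃[o]m+o≡n sᵢ<K =
  +-cancelʳ-≤ (3 * r) _ _ (begin
    -- The four other terms exceed the deficit by 3 (1 + δ), and r ≤ 1 ≤ 1 + δ. Adding 3 r on both
    -- sides avoids subtraction.
    5 * K + 3 * r                           ≤⟨ +-monoʳ-≤ (5 * K) (*-monoʳ-≤ 3 (≤-trans r≤1 (s≤s z≤n))) ⟩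
    5 * K + 3 * suc δ                       ≡⟨ lem₁ (s i) δ ⟩
    s i + 4 * (K + suc δ)                   ≤⟨ +-monoʳ-≤ (s i) (sum-lower others large) ⟩
    s i + (sum others + 4 * r)              ≡⟨ lem₂ (s i) (sum others) r ⟩
    s i + sum others + r + 3 * r            ≡⟨ cong (λ σ → σ + r + 3 * r) (sum-remove {i = i} s) ⟨
    sum s + r + 3 * r                       ∎)
  where
  open ≤-Reasoning
  others : Fin 4 → ℕ
  others j = s (Fin.punchIn i j)
  lem₁ : ∀ a δ → 5 * (suc a + δ) + 3 * suc δ ≡ a + 4 * (suc a + δ + suc δ)
  lem₁ = solve-∀
  lem₂ : ∀ a b r → a + (b + 4 * r) ≡ a + b + r + 3 * r
  lem₂ = solve-∀
  lem₃ : ∀ a δ → a + (suc a + δ + suc δ) ≡ 2 * (suc a + δ)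
  lem₃ = solve-∀
  large : ∀ j → suc (s i) + δ + suc δ ≤ others j + r
  large j = +-cancelˡ-≤ (s i) _ _ (begin
    s i + (suc (s i) + δ + suc δ)  ≡⟨ lem₃ (s i) δ ⟩
    2 * (suc (s i) + δ)            ≤⟨ pairs (Finₚ.punchInᵢ≢i i j ∘ sym) ⟩
    s i + others j + r             ≡⟨ +-assoc (s i) (others j) r ⟩
    s i + (others j + r)           ∎)

-- Used with r = 0 when n = 2K + 1 and with r = 1 when n = 2K.
μ-5-3-bound : ∀ ℓ {K r} → r ≤ 1 → K > 0 → 2 * K ≤ μ ℓ 5 3 + r → 5 * K ≤ ℓ + r
-- No maximizing partition is extracted. If the bound fails, every partition has a value below 2K -
-- r, and so does the maximum.
μ-5-3-bound ℓ {K} {r} r≤1 K>0 2K≤μ+r = decidable-stable (5 * K ≤? ℓ + r) λ 5K≰ℓ+r →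
  <⇒≱ (begin-strict
    μ ℓ 5 3 + r    <⟨ +-monoˡ-< r (max<v⁺ {xs = List.map (λ F → μ-of F 3) (partitions ℓ 5)}
                        (m<n⇒0<n∸m r<2K) (Allₚ.map⁺ (All.map (small 5K≰ℓ+r) all-partitions))) ⟩
    2 * K ∸ r + r  ≡⟨ m∸n+n≡m (<⇒≤ r<2K) ⟩
    2 * K          ∎) 2K≤μ+r
  where
  open ≤-Reasoning
  -- This makes `2 * K ∸ r` positive, so that the default value 0 of `max` lies below it as well.
  r<2K : r < 2 * K
  r<2K = ≤-trans (s≤s r≤1) (*-monoʳ-≤ 2 K>0)
  all-partitions : All IsPartition (partitions ℓ 5)
  all-partitions = Allₚ.all-filter isPartition? (vectors 5 (subsets ℓ))
  large : ∀ {F : Vec (Subset ℓ) 5} → IsPartition F → 2 * K ∸ r ≤ μ-of F 3 → 5 * K ≤ ℓ + r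
  large {F} part@(_ , F# , ⋃F≡⊤) ≤μ = begin
    5 * K                           ≤⟨ five-sum-lower (λ i → ∣ lookup F i ∣) {K} r≤1 pairs ⟩
    sum (λ i → ∣ lookup F i ∣) + r  ≤⟨ +-monoˡ-≤ r (sum-∣blocks∣≤∣⋃∣ F F#) ⟩
    ∣ ⋃ (toList F) ∣ + r            ≡⟨ cong (λ S → ∣ S ∣ + r) ⋃F≡⊤ ⟩
    ∣ ⊤ {n = ℓ} ∣ + r               ≡⟨ cong (_+ r) (∣⊤∣≡n ℓ) ⟩
    ℓ + r                           ∎
    where
    pairs : ∀ {p q} → p ≢ q → 2 * K ≤ ∣ lookup F p ∣ + ∣ lookup F q ∣ + r
    pairs p≢q = begin
      2 * K          ≡⟨ m∸n+n≡m (<⇒≤ r<2K) ⟨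
      2 * K ∸ r + r  ≤⟨ +-monoˡ-≤ r (≤-trans ≤μ (μ-of-≤-two-blocks F part p≢q)) ⟩
      _              ∎
  small : ¬ 5 * K ≤ ℓ + r → ∀ {F : Vec (Subset ℓ) 5} → IsPartition F → μ-of F 3 < 2 * K ∸ r
  small 5K≰ℓ+r part = ≰⇒> (5K≰ℓ+r ∘ large part)

-- Edge lists

lookup-injective : ∀ {A B : Set} (f : A → B) {xs} → Unique (List.map f xs) →
                   ∀ i j → f (List.lookup xs i) ≡ f (List.lookup xs j) → i ≡ j
lookup-injective f {_ ∷ _} (_  ∷ _)   zero    zero    _  = refl
lookup-injective f {_ ∷ _} (x∉ ∷ _)   zero    (suc j) eq =
  contradiction eq (All.lookup x∉ (Listₘ.∈-map⁺ f (Listₘ.∈-lookup j)))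
lookup-injective f {_ ∷ _} (x∉ ∷ _)   (suc i) zero    eq =
  contradiction (sym eq) (All.lookup x∉ (Listₘ.∈-map⁺ f (Listₘ.∈-lookup i)))
lookup-injective f {_ ∷ _} (_  ∷ xs!) (suc i) (suc j) eq =
  cong suc (lookup-injective f xs! i j eq)

-- Pigeonhole: sending an index of `xs` to the place of its entry in `ys` is injective.
unique⊆⇒length≤ : ∀ {A : Set} {xs ys : List A} → Unique xs → (∀ {x} → x ∈ᴸ xs → x ∈ᴸ ys) →
                  length xs ≤ length ys
unique⊆⇒length≤ {xs = xs} {ys} xs! xs⊆ys = Finₚ.injective⇒≤ {f = position} λ {i} {j} eq →
  lookup-injective id (subst Unique (sym (Listₚ.map-id xs)) xs!) i j
    (trans (at i) (trans (cong (List.lookup ys) eq) (sym (at j))))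
  where
  found : ∀ i → List.lookup xs i ∈ᴸ ys
  found i = xs⊆ys (Listₘ.∈-lookup i)
  position : Fin (length xs) → Fin (length ys)
  position i = Any.index (found i)
  at : ∀ i → List.lookup xs i ≡ List.lookup ys (position i)
  at i = Anyₚ.lookup-index (found i)

-- Edges are stored with their smaller end node first.

Ends : Set
Ends = ℕ × ℕ

Edge : ℕ → Set
Edge c = Ends × Fin c

Ordered : ℕ → Ends → Set
Ordered n (x , y) = x < y × y < n

Simple : ℕ → List Ends → Set
Simple n es = All (Ordered n) es × Unique es

fan : ℕ → List ℕ → List Ends
fan n = List.map (_, n)

-- All new edges have n as larger end and all old ones stay below n, so no edge is repeated.
fan-simple : ∀ {n xs es} → All (_< n) xs → Unique xs → Simple n es →
             Simple (suc n) (fan n xs ++ es)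
fan-simple {n} {xs} {es} xs< xs! (es< , es!) =
  Allₚ.++⁺ (Allₚ.map⁺ (All.map (λ x<n → x<n , ≤-refl) xs<))
           (All.map (λ (x<y , y<n) → x<y , m<n⇒m<1+n y<n) es<)
  , Uniqueₚ.++⁺ (Uniqueₚ.map⁺ (proj₁ ∘ ,-injective) xs!) es! disjoint
  where
  disjoint : ∀ {e} → ¬ (e ∈ᴸ fan n xs × e ∈ᴸ es)
  disjoint (e∈fan , e∈es) with x , _ , refl ← Listₘ.∈-map⁻ (_, n) e∈fan =
    <-irrefl refl (proj₂ (All.lookup es< e∈es))

complete : ℕ → List Ends
complete zero    = []
complete (suc n) = fan n (upTo n) ++ complete n

complete-simple : ∀ n → Simple n (complete n)
complete-simple zero    = [] , []
complete-simple (suc n) = fan-simple (Allₚ.all-upTo n) (Uniqueₚ.upTo⁺ n) (complete-simple n)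

length-complete : ∀ n → length (complete n) * 2 ≡ n * (n ∸ 1)
length-complete zero          = refl
length-complete (suc zero)    = refl
length-complete (suc n@(suc k)) = begin
  length (fan n (upTo n) ++ complete n) * 2
    ≡⟨ cong (_* 2) (Listₚ.length-++ (fan n (upTo n))) ⟩
  (length (fan n (upTo n)) + length (complete n)) * 2
    ≡⟨ cong (λ l → (l + length (complete n)) * 2)
            (trans (Listₚ.length-map (_, n) (upTo n)) (Listₚ.length-upTo n)) ⟩
  (n + length (complete n)) * 2                      ≡⟨ *-distribʳ-+ 2 n (length (complete n)) ⟩
  n * 2 + length (complete n) * 2                    ≡⟨ cong (n * 2 +_) (length-complete n) ⟩
  n * 2 + n * k                                      ≡⟨ lem k ⟩
  suc n * n                                          ∎
  where
  open ≡-Reasoning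
  lem : ∀ k → suc k * 2 + suc k * k ≡ suc (suc k) * suc k
  lem = solve-∀

-- Connectivity

-- Each edge is stored in one direction only, hence the equivalence closure. Nodes are plain
-- numbers, so that links persist when nodes and edges are added.
Linked : ∀ {c} → (Fin c → Set) → List (Edge c) → ℕ → ℕ → Set
Linked P es = EqClosure λ x y → ∃[ a ] P a × ((x , y) , a) ∈ᴸ es

Spanning : ∀ {c} → (Fin c → Set) → ℕ → List (Edge c) → Set
Spanning P n es = ∀ {x y} → x < n → y < n → Linked P es x y

module _ {c} {P : Fin c → Set} where

  Linked-mono : ∀ {es es′} → (∀ {e} → e ∈ᴸ es → e ∈ᴸ es′) → ∀ {x y} →
                Linked P es x y → Linked P es′ x y
  Linked-mono es⊆ = EqC.map λ (a , Pa , e∈) → a , Pa , es⊆ e∈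

  Linked-sym : ∀ {es x y} → Linked P es x y → Linked P es y x
  Linked-sym = EqC.symmetric _

  edge : ∀ {es x y a} → P a → ((x , y) , a) ∈ᴸ es → Linked P es x y
  edge Pa e∈ = EqC.return (_ , Pa , e∈)

  edge⁻¹ : ∀ {es x y a} → P a → ((x , y) , a) ∈ᴸ es → Linked P es y x
  edge⁻¹ Pa e∈ = Linked-sym (edge Pa e∈)

  hub-spanning : ∀ {n es h} → (∀ {x} → x < n → Linked P es x h) → Spanning P n es
  hub-spanning to-hub x<n y<n = to-hub x<n ◅◅ Linked-sym (to-hub y<n)

-- Paths from walks

module _ {n ℓ} (G : Graph n ℓ) where
  open Graph G

  open DecMem (Fin._≟_ {n}) using () renaming (_∈?_ to _∈ᴸ?_)

  from-node : ∀ {Q : Fin ℓ → Set} {x y z} (w : Walk y z) → IsPath w → All Q (edges w) →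
              x ∈ᴸ nodes w → Σ[ w′ ∈ Walk x z ] IsPath w′ × All Q (edges w′)
  from-node nil          w!       Qw       (here refl) = nil , w! , Qw
  from-node (cons e j w) w!       Qw       (here refl) = cons e j w , w! , Qw
  from-node (cons e j w) (_ ∷ w!) (_ ∷ Qw) (there x∈)  = from-node w w! Qw x∈

  -- Loop erasure from the far end: if the path obtained for the tail already meets x, its part from
  -- x on serves.
  walk⇒path : ∀ {Q : Fin ℓ → Set} {x y} (w : Walk x y) → All Q (edges w) →
              Σ[ w′ ∈ Walk x y ] IsPath w′ × All Q (edges w′)
  walk⇒path nil                  _          = nil , [] ∷ [] , []
  walk⇒path {x = x} (cons e j w) (Qe ∷ Qw) with w′ , w′! , Qw′ ← walk⇒path w Qw | x ∈ᴸ? nodes w′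
  ... | yes x∈ = from-node w′ w′! Qw′ x∈
  ... | no  x∉ = cons e j w′ , Allₚ.¬Any⇒All¬ _ x∉ ∷ w′! , Qe ∷ Qw′

-- The colored graph of a list of edges

module _ {n c} (es : List (Edge c)) (simple : Simple n (List.map proj₁ es))
         (colors : ∀ a → ∃[ e ] (e , a) ∈ᴸ es) where

  private
    endsᴺ : Fin (length es) → Ends
    endsᴺ i = proj₁ (List.lookup es i)

    ordered : ∀ i → Ordered n (endsᴺ i)
    ordered i = All.lookup (proj₁ simple) (Listₘ.∈-map⁺ proj₁ (Listₘ.∈-lookup i))

    ends : Fin (length es) → Fin n × Fin n
    ends i with x<y , y<n ← ordered i = fromℕ< (<-trans x<y y<n) , fromℕ< y<n

    toℕ² : Fin n × Fin n → Ends
    toℕ² (x , y) = toℕ x , toℕ y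

    toℕ²-ends : ∀ i → toℕ² (ends i) ≡ endsᴺ i
    toℕ²-ends i with x<y , y<n ← ordered i =
      cong₂ _,_ (Finₚ.toℕ-fromℕ< (<-trans x<y y<n)) (Finₚ.toℕ-fromℕ< y<n)

    ends-< : ∀ i → toℕ (proj₁ (ends i)) < toℕ (proj₂ (ends i))
    ends-< i = subst (λ (x , y) → x < y) (sym (toℕ²-ends i)) (proj₁ (ordered i))

    ends-injective : ∀ {i j} → ends i ≡ ends j → i ≡ j
    ends-injective {i} {j} eq =
      lookup-injective proj₁ (proj₂ simple) i j
        (trans (sym (toℕ²-ends i)) (trans (cong toℕ² eq) (toℕ²-ends j)))

    -- Two edges in opposite orientation would give both x < y and y < x, because the smaller end
    -- always comes first.
    same-ends : ∀ {i j x y} → ends i ≡ (x , y) ⊎ ends i ≡ (y , x) →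
                ends j ≡ (x , y) ⊎ ends j ≡ (y , x) → i ≡ j
    same-ends (inj₁ p) (inj₁ q) = ends-injective (trans p (sym q))
    same-ends (inj₂ p) (inj₂ q) = ends-injective (trans p (sym q))
    same-ends {i} {j} (inj₁ p) (inj₂ q) = contradiction
      (subst (λ (x , y) → toℕ x < toℕ y) p (ends-< i)) (<⇒≯ (subst (λ (x , y) → toℕ x < toℕ y) q (ends-< j)))
    same-ends {i} {j} (inj₂ p) (inj₁ q) = contradiction
      (subst (λ (x , y) → toℕ x < toℕ y) p (ends-< i)) (<⇒≯ (subst (λ (x , y) → toℕ x < toℕ y) q (ends-< j)))

  listGraph : ColoredEdgeGraph n (length es) c
  listGraph = record
    { graph = record
      { ends       = ends
      ; loopless   = λ i eq → <-irrefl (cong toℕ eq) (ends-< i)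
      ; unrepeated = same-ends
      }
    ; color            = λ i → proj₂ (List.lookup es i)
    ; color-surjective = λ a → let _ , ea∈ = colors a in
        Any.index ea∈ , λ { refl → cong proj₂ (sym (Anyₚ.lookup-index ea∈)) }
    }

  open ColoredEdgeGraph listGraph using (Walk; nil; cons; edges; color; graph)

  private
    ends-∈ : ∀ {x y a} (e∈ : ((x , y) , a) ∈ᴸ es) →
             Σ[ i ∈ Fin (length es) ] Σ[ x′ ∈ Fin n ] Σ[ y′ ∈ Fin n ]
               ends i ≡ (x′ , y′) × toℕ x′ ≡ x × toℕ y′ ≡ y × color i ≡ a
    ends-∈ e∈ = i , _ , _ , refl , cong proj₁ same , cong proj₂ same
              , cong proj₂ (sym (Anyₚ.lookup-index e∈))
      where
      i = Any.index e∈
      same = trans (toℕ²-ends i) (cong proj₁ (sym (Anyₚ.lookup-index e∈)))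

  -- The intermediate nodes are mere numbers, but each is an end of an edge in `es` and so lifts to
  -- `Fin n`. A backward step reads its edge through the second alternative of `Joins`.
  Linked⇒walk : ∀ {P : Fin c → Set} {x y} → Linked P es x y → ∀ A B → toℕ A ≡ x → toℕ B ≡ y →
                Σ[ w ∈ Walk A B ] All (P ∘ color) (edges w)
  Linked⇒walk ε A B refl B≡A with refl ← Finₚ.toℕ-injective B≡A = nil , []
  Linked⇒walk (fwd (a , Pa , e∈) ◅ rest) A B refl refl
    with i , x′ , y′ , eq , x≡ , y≡ , refl ← ends-∈ e∈
    with refl ← Finₚ.toℕ-injective x≡
    with w , Pw ← Linked⇒walk rest y′ B y≡ refl = cons i (inj₁ eq) w , Pa ∷ Pw
  Linked⇒walk (bwd (a , Pa , e∈) ◅ rest) A B refl refl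
    with i , x′ , y′ , eq , x≡ , y≡ , refl ← ends-∈ e∈
    with refl ← Finₚ.toℕ-injective y≡
    with w , Pw ← Linked⇒walk rest x′ B x≡ refl = cons i (inj₂ eq) w , Pa ∷ Pw

  listGraph-connected : ∀ {t} → (∀ (S : Subset c) → ∣ S ∣ ≡ t → Spanning (_∉ S) n es) →
                        [ t +1]-ColorConnected listGraph
  listGraph-connected span A B _ S ∣S∣≡t =
    let w , w∉S = Linked⇒walk (span S ∣S∣≡t (Finₚ.toℕ<n A) (Finₚ.toℕ<n B)) A B refl refl
    in walk⇒path graph w w∉S

-- Adding edges to a colored edge graph

module _ {n c} (es : List (Edge (suc c))) (simple : Simple n (List.map proj₁ es)) where

  private
    used = List.map proj₁ es
    open DecMem (≡-dec _≟_ _≟_) using () renaming (_∈?_ to _∈ᴸ?_)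
    unused = filter (λ e → ¬? (e ∈ᴸ? used)) (complete n)

  pad : ℕ → List (Edge (suc c))
  pad ℓ = es ++ List.map (_, zero) (take (ℓ ∸ length es) unused)

  pad-length : ∀ {ℓ} → length es ≤ ℓ → ℓ ≤ length (complete n) → length (pad ℓ) ≡ ℓ
  pad-length {ℓ} ≤ℓ ℓ≤ = begin
    length (pad ℓ)                                   ≡⟨ Listₚ.length-++ es ⟩
    length es + length (List.map (_, zero) (take r unused))
      ≡⟨ cong (length es +_) (Listₚ.length-map _ (take r unused)) ⟩
    length es + length (take r unused)               ≡⟨ cong (length es +_) (Listₚ.length-take r unused) ⟩
    length es + r ⊓ length unused                    ≡⟨ cong (length es +_) (m≤n⇒m⊓n≡m r≤) ⟩
    length es + r                                    ≡⟨ m+[n∸m]≡n ≤ℓ ⟩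
    ℓ                                                ∎
    where
    open ≡-Reasoning
    r = ℓ ∸ length es
    complete⊆ : ∀ {e} → e ∈ᴸ complete n → e ∈ᴸ used ++ unused
    complete⊆ {e} e∈ with e ∈ᴸ? used
    ... | yes e∈used = Listₘ.∈-++⁺ˡ e∈used
    ... | no  e∉used = Listₘ.∈-++⁺ʳ used (Listₘ.∈-filter⁺ _ e∈ e∉used)
    r≤ : r ≤ length unused
    r≤ = m≤n+o⇒m∸n≤o ℓ (length es) (≤-trans ℓ≤ (≤-trans
      (unique⊆⇒length≤ (proj₂ (complete-simple n)) complete⊆)
      (≤-reflexive (trans (Listₚ.length-++ used) (cong (_+ length unused) (Listₚ.length-map proj₁ es))))))

  pad-simple : ∀ ℓ → Simple n (List.map proj₁ (pad ℓ))
  pad-simple ℓ = subst (Simple n) (sym (ends-pad (take r unused)))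
    ( Allₚ.++⁺ (proj₁ simple) (Allₚ.take⁺ r (Allₚ.filter⁺ _ (proj₁ (complete-simple n))))
    , Uniqueₚ.++⁺ (proj₂ simple) (Uniqueₚ.take⁺ r (Uniqueₚ.filter⁺ _ (proj₂ (complete-simple n))))
        λ (e∈used , e∈) → All.lookup (Allₚ.take⁺ r (Allₚ.all-filter _ (complete n))) e∈ e∈used )
    where
    r = ℓ ∸ length es
    ends-pad : ∀ xs → List.map proj₁ (es ++ List.map (_, zero {c}) xs) ≡ used ++ xs
    ends-pad xs = trans (Listₚ.map-++ proj₁ es _)
      (cong (used ++_) (trans (sym (Listₚ.map-∘ xs)) (Listₚ.map-id xs)))

  padded-graph : ∀ {t ℓ} → (∀ a → ∃[ e ] (e , a) ∈ᴸ es) →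
                 (∀ (S : Subset (suc c)) → ∣ S ∣ ≡ t → Spanning (_∉ S) n es) →
                 length es ≤ ℓ → ℓ ≤ length (complete n) →
                 Σ[ G ∈ ColoredEdgeGraph n ℓ (suc c) ] [ t +1]-ColorConnected G
  padded-graph {t} {ℓ} colors span ≤ℓ ℓ≤ =
    subst (λ ℓ → Σ[ G ∈ ColoredEdgeGraph n ℓ (suc c) ] [ t +1]-ColorConnected G) (pad-length ≤ℓ ℓ≤)
      (listGraph (pad ℓ) (pad-simple ℓ) colors′ ,
       listGraph-connected (pad ℓ) (pad-simple ℓ) colors′
         λ S ∣S∣≡t x<n y<n → Linked-mono Listₘ.∈-++⁺ˡ (span S ∣S∣≡t x<n y<n))
    where
    colors′ : ∀ a → ∃[ e ] (e , a) ∈ᴸ pad ℓ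
    colors′ a = let e , e∈ = colors a in e , Listₘ.∈-++⁺ˡ e∈

-- The ladder

pattern A = zero
pattern B = suc zero
pattern C = suc (suc zero)
pattern D = suc (suc (suc zero))
pattern E = suc (suc (suc (suc zero)))

star : ℕ → List (ℕ × Fin 5) → List (Edge 5)
star n = List.map λ (x , a) → (x , n) , a

-- uᵢ and vᵢ have the numbers 2i and 2i + 1.  The ladder with index j has the
-- m = j + 1 rungs uᵢ vᵢ with i ≤ j, so that w has the number 2m = u (suc j).
u : ℕ → ℕ
u zero    = 0
u (suc j) = 2 + u j

v : ℕ → ℕ
v j = suc (u j)

-- A step adds first u (suc j), joined back by A and E, then v (suc j), joined back by D and B and
-- to its partner by C: one edge of each color.
ladder : ℕ → List (Edge 5)
ladder zero    = star 1 ((0 , C) ∷ [])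
ladder (suc j) = star (v (suc j)) ((u j , D) ∷ (v j , B) ∷ (u (suc j) , C) ∷ [])
              ++ star (u (suc j)) ((u j , A) ∷ (v j , E) ∷ []) ++ ladder j

-- The neighbors of w. A and B are attached to the side opposite to their own rail, so that w joins
-- the two rails.
rim : ℕ → List (ℕ × Fin 5)
rim j = (1 , A) ∷ (0 , B) ∷ (u j , D) ∷ (v j , E) ∷ []

odd : ℕ → List (Edge 5)
odd j = star (u (suc j)) (rim j) ++ ladder j

-- The neighbors of the additional node for even n. Of any two distinct colors at least one differs
-- from C and so occurs here.
apex : List (ℕ × Fin 5)
apex = (0 , A) ∷ (1 , B) ∷ (2 , D) ∷ (3 , E) ∷ []

even : ℕ → List (Edge 5)
even j = star (v (suc j)) apex ++ odd j

ends : List (Edge 5) → List Ends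
ends = List.map proj₁

u< : ∀ j → u j < u (suc j)
u< j = n≤1+n _

v< : ∀ j → v j < u (suc j)
v< j = ≤-refl

ladder-simple : ∀ j → Simple (u (suc j)) (ends (ladder j))
ladder-simple zero    = fan-simple (s≤s z≤n ∷ []) ([] ∷ []) ([] , [])
ladder-simple (suc j) =
  fan-simple (m≤n+m _ 2 ∷ n≤1+n _ ∷ ≤-refl ∷ [])
             ((m≢1+n+m _ {0} ∷ m≢1+n+m _ {1} ∷ []) ∷ (m≢1+n+m _ {0} ∷ []) ∷ [] ∷ [])
    (fan-simple (n≤1+n _ ∷ ≤-refl ∷ []) ((m≢1+n+m _ {0} ∷ []) ∷ [] ∷ []) (ladder-simple j))

-- The index `suc j` ensures two rungs; with a single one, `rim` would list each of 0 and 1 twice.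
odd-simple : ∀ j → Simple (v (2 + j)) (ends (odd (suc j)))
odd-simple j = fan-simple (s≤s (s≤s z≤n) ∷ s≤s z≤n ∷ n≤1+n _ ∷ ≤-refl ∷ [])
  (((λ ()) ∷ (λ ()) ∷ (λ ()) ∷ []) ∷ ((λ ()) ∷ (λ ()) ∷ []) ∷ (m≢1+n+m _ {0} ∷ []) ∷ [] ∷ [])
  (ladder-simple (suc j))

even-simple : ∀ j → Simple (u (3 + j)) (ends (even (suc j)))
even-simple j = fan-simple
  (s≤s z≤n ∷ s≤s (s≤s z≤n) ∷ s≤s (s≤s (s≤s z≤n)) ∷ s≤s (s≤s (s≤s (s≤s z≤n))) ∷ [])
  (((λ ()) ∷ (λ ()) ∷ (λ ()) ∷ []) ∷ ((λ ()) ∷ (λ ()) ∷ []) ∷ ((λ ()) ∷ []) ∷ [] ∷ [])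
  (odd-simple j)

ladder-induction : ∀ (Q : ℕ → Set) j → (∀ {x} → x < u (suc j) → Q x) →
                   Q (u (suc j)) → Q (v (suc j)) → ∀ {x} → x < u (2 + j) → Q x
ladder-induction Q j old Qu Qv x< with m<1+n⇒m<n∨m≡n x<
... | inj₂ refl = Qv
... | inj₁ x<′ with m<1+n⇒m<n∨m≡n x<′
...   | inj₂ refl = Qu
...   | inj₁ x<″ = old x<″

-- Components of the ladder under two colors

module _ {P : Fin 5 → Set} where

  private
    _≈[_]_ : ℕ → ℕ → ℕ → Set
    x ≈[ j ] y = Linked P (ladder j) x y

  grow : ∀ j {x y} → x ≈[ j ] y → x ≈[ suc j ] y
  grow j = Linked-mono (there ∘ there ∘ there ∘ there ∘ there)

  D-rung : P D → ∀ j → u j ≈[ suc j ] v (suc j)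
  D-rung d j = edge d (here refl)

  B-rail : P B → ∀ j → v j ≈[ suc j ] v (suc j)
  B-rail b j = edge b (there (here refl))

  C-rung : P C → ∀ j → u (suc j) ≈[ suc j ] v (suc j)
  C-rung c j = edge c (there (there (here refl)))

  A-rail : P A → ∀ j → u j ≈[ suc j ] u (suc j)
  A-rail a j = edge a (there (there (there (here refl))))

  E-rung : P E → ∀ j → v j ≈[ suc j ] u (suc j)
  E-rung e j = edge e (there (there (there (there (here refl)))))

  u-path : P A → ∀ j → u j ≈[ j ] 0
  u-path a zero    = ε
  u-path a (suc j) = Linked-sym (A-rail a j) ◅◅ grow j (u-path a j)

  v-path : P B → ∀ j → v j ≈[ j ] 1
  v-path b zero    = ε
  v-path b (suc j) = Linked-sym (B-rail b j) ◅◅ grow j (v-path b j)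

  -- The components are the two rails, represented by their first nodes.
  ladder-AB : P A → P B → ∀ j {x} → x < u (suc j) → x ≈[ j ] 0 ⊎ x ≈[ j ] 1
  ladder-AB a b zero (s≤s z≤n)       = inj₁ ε
  ladder-AB a b zero (s≤s (s≤s z≤n)) = inj₂ ε
  ladder-AB a b (suc j) = ladder-induction (λ x → x ≈[ suc j ] 0 ⊎ x ≈[ suc j ] 1) j
    (Sum.map (grow j) (grow j) ∘ ladder-AB a b j)
    (inj₁ (u-path a (suc j)))
    (inj₂ (v-path b (suc j)))

  -- D and E form two zigzags that change sides at every rung. They are represented by their last
  -- nodes, and the alternatives are swapped in the inductive step.
  ladder-DE : P D → P E → ∀ j {x} → x < u (suc j) → x ≈[ j ] u j ⊎ x ≈[ j ] v j
  ladder-DE d e zero (s≤s z≤n)       = inj₁ ε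
  ladder-DE d e zero (s≤s (s≤s z≤n)) = inj₂ ε
  ladder-DE d e (suc j) = ladder-induction (λ x → x ≈[ suc j ] u (suc j) ⊎ x ≈[ suc j ] v (suc j)) j
    (λ x< → [ inj₂ ∘ (_◅◅ D-rung d j) ∘ grow j , inj₁ ∘ (_◅◅ E-rung e j) ∘ grow j ]′ (ladder-DE d e j x<))
    (inj₁ ε)
    (inj₂ ε)

  -- D attaches every v except v₀ = 1 to the rail of A. For B and E the exception is u₀ = 0, by
  -- symmetry.
  ladder-AD : P A → P D → ∀ j {x} → x < u (suc j) → x ≈[ j ] u j ⊎ x ≈[ j ] 1
  ladder-AD a d zero (s≤s z≤n)       = inj₁ ε
  ladder-AD a d zero (s≤s (s≤s z≤n)) = inj₂ ε
  ladder-AD a d (suc j) = ladder-induction (λ x → x ≈[ suc j ] u (suc j) ⊎ x ≈[ suc j ] 1) j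
    (Sum.map ((_◅◅ A-rail a j) ∘ grow j) (grow j) ∘ ladder-AD a d j)
    (inj₁ ε)
    (inj₁ (Linked-sym (D-rung d j) ◅◅ A-rail a j))

  ladder-BE : P B → P E → ∀ j {x} → x < u (suc j) → x ≈[ j ] 0 ⊎ x ≈[ j ] v j
  ladder-BE b e zero (s≤s z≤n)       = inj₁ ε
  ladder-BE b e zero (s≤s (s≤s z≤n)) = inj₂ ε
  ladder-BE b e (suc j) = ladder-induction (λ x → x ≈[ suc j ] 0 ⊎ x ≈[ suc j ] v (suc j)) j
    (Sum.map (grow j) ((_◅◅ B-rail b j) ∘ grow j) ∘ ladder-BE b e j)
    (inj₂ (Linked-sym (E-rung e j) ◅◅ B-rail b j))
    (inj₂ ε)

  -- E attaches every v except the last to the rail of A; the last one stays isolated until the next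
  -- rung is added. B and D behave alike, with the last u.
  ladder-AE : P A → P E → ∀ j {x} → x < u (suc j) → x ≈[ j ] 0 ⊎ x ≡ v j
  ladder-AE a e zero (s≤s z≤n)       = inj₁ ε
  ladder-AE a e zero (s≤s (s≤s z≤n)) = inj₂ refl
  ladder-AE a e (suc j) = ladder-induction (λ x → x ≈[ suc j ] 0 ⊎ x ≡ v (suc j)) j
    (λ x< → inj₁ ([ grow j , (λ { refl → E-rung e j ◅◅ u-path a (suc j) }) ]′ (ladder-AE a e j x<)))
    (inj₁ (u-path a (suc j)))
    (inj₂ refl)

  ladder-BD : P B → P D → ∀ j {x} → x < u (suc j) → x ≈[ j ] 1 ⊎ x ≡ u j
  ladder-BD b d zero (s≤s z≤n)       = inj₂ refl
  ladder-BD b d zero (s≤s (s≤s z≤n)) = inj₁ ε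
  ladder-BD b d (suc j) = ladder-induction (λ x → x ≈[ suc j ] 1 ⊎ x ≡ u (suc j)) j
    (λ x< → inj₁ ([ grow j , (λ { refl → D-rung d j ◅◅ v-path b (suc j) }) ]′ (ladder-BD b d j x<)))
    (inj₂ refl)
    (inj₁ (v-path b (suc j)))

  -- C joins the two nodes of each rung, so one further color, having an edge between any two
  -- consecutive rungs, connects the ladder. This also gives the next three lemmas.
  ladder-CA : P C → P A → ∀ j {x} → x < u (suc j) → x ≈[ j ] 0
  ladder-CA c a zero (s≤s z≤n)       = ε
  ladder-CA c a zero (s≤s (s≤s z≤n)) = edge⁻¹ c (here refl)
  ladder-CA c a (suc j) = ladder-induction (_≈[ suc j ] 0) j
    (grow j ∘ ladder-CA c a j)
    (u-path a (suc j))
    (Linked-sym (C-rung c j) ◅◅ u-path a (suc j))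

  ladder-CB : P C → P B → ∀ j {x} → x < u (suc j) → x ≈[ j ] 1
  ladder-CB c b zero (s≤s z≤n)       = edge c (here refl)
  ladder-CB c b zero (s≤s (s≤s z≤n)) = ε
  ladder-CB c b (suc j) = ladder-induction (_≈[ suc j ] 1) j
    (grow j ∘ ladder-CB c b j)
    (C-rung c j ◅◅ v-path b (suc j))
    (v-path b (suc j))

  ladder-CD : P C → P D → ∀ j {x} → x < u (suc j) → x ≈[ j ] 0
  ladder-CD c d zero (s≤s z≤n)       = ε
  ladder-CD c d zero (s≤s (s≤s z≤n)) = edge⁻¹ c (here refl)
  ladder-CD c d (suc j) = ladder-induction (_≈[ suc j ] 0) j
    (grow j ∘ ladder-CD c d j)
    (C-rung c j ◅◅ Linked-sym (D-rung d j) ◅◅ uj≈0)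
    (Linked-sym (D-rung d j) ◅◅ uj≈0)
    where uj≈0 = grow j (ladder-CD c d j (u< j))

  ladder-CE : P C → P E → ∀ j {x} → x < u (suc j) → x ≈[ j ] 0
  ladder-CE c e zero (s≤s z≤n)       = ε
  ladder-CE c e zero (s≤s (s≤s z≤n)) = edge⁻¹ c (here refl)
  ladder-CE c e (suc j) = ladder-induction (_≈[ suc j ] 0) j
    (grow j ∘ ladder-CE c e j)
    (Linked-sym (E-rung e j) ◅◅ vj≈0)
    (Linked-sym (C-rung c j) ◅◅ Linked-sym (E-rung e j) ◅◅ vj≈0)
    where vj≈0 = grow j (ladder-CE c e j (v< j))

  -- The new node n is the hub. The neighbor h may depend on x, so the old part need not be
  -- connected; this is how w joins two components.
  fan-spanning : ∀ {n es} nbrs →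
    (∀ {x} → x < n → ∃[ h ] ∃[ a ] P a × (h , a) ∈ᴸ nbrs × Linked P es x h) →
    Spanning P (suc n) (star n nbrs ++ es)
  fan-spanning {n} {es} nbrs hub = hub-spanning to-n
    where
    to-n : ∀ {x} → x < suc n → Linked P (star n nbrs ++ es) x n
    to-n x<1+n with m<1+n⇒m<n∨m≡n x<1+n
    ... | inj₂ refl = ε
    ... | inj₁ x<n with _ , _ , Pa , ha∈ , x~h ← hub x<n =
      Linked-mono (Listₘ.∈-++⁺ʳ (star n nbrs)) x~h ◅◅
      edge Pa (Listₘ.∈-++⁺ˡ (Listₘ.∈-map⁺ _ ha∈))

-- Connectedness by any two colors

color-pairs : List (Fin 5 × Fin 5)
color-pairs = (A , B) ∷ (A , D) ∷ (A , E) ∷ (B , D) ∷ (B , E) ∷ (D , E)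
            ∷ (A , C) ∷ (B , C) ∷ (D , C) ∷ (E , C) ∷ []

ReachesRim : (Fin 5 → Set) → ℕ → ℕ → Set
ReachesRim P j x = ∃[ h ] ∃[ a ] P a × (h , a) ∈ᴸ rim j × Linked P (ladder j) x h

-- For each pair, every component found above contains a neighbor of w whose edge to w has one of
-- the two colors.
ladder-reaches-rim : All (λ (a , b) → ∀ {P} → P a → P b → ∀ j {x} →
                          x < u (2 + j) → ReachesRim P (suc j) x) color-pairs
ladder-reaches-rim =
    (λ a b j x< → [ via-B b j , via-A a j ]′ (ladder-AB a b (suc j) x<))
  ∷ (λ a d j x< → [ via-D d j , via-A a j ]′ (ladder-AD a d (suc j) x<))
  ∷ (λ a e j x< → [ (λ x≈0 → via-A a j (x≈0 ◅◅ 0≈1 a e j)) , (λ { refl → via-E e j ε }) ]′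
                    (ladder-AE a e (suc j) x<))
  ∷ (λ b d j x< → [ (λ x≈1 → via-B b j (x≈1 ◅◅ 1≈0 b d j)) , (λ { refl → via-D d j ε }) ]′
                    (ladder-BD b d (suc j) x<))
  ∷ (λ b e j x< → [ via-B b j , via-E e j ]′ (ladder-BE b e (suc j) x<))
  ∷ (λ d e j x< → [ via-D d j , via-E e j ]′ (ladder-DE d e (suc j) x<))
  ∷ (λ a c j x< → via-A a j (ladder-CA c a (suc j) x< ◅◅ Linked-sym (ladder-CA c a (suc j) (s≤s (s≤s z≤n)))))
  ∷ (λ b c j x< → via-B b j (ladder-CB c b (suc j) x< ◅◅ Linked-sym (ladder-CB c b (suc j) (s≤s z≤n))))
  ∷ (λ d c j x< → via-D d j (ladder-CD c d (suc j) x< ◅◅ Linked-sym (ladder-CD c d (suc j) (u< (suc j)))))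
  ∷ (λ e c j x< → via-E e j (ladder-CE c e (suc j) x< ◅◅ Linked-sym (ladder-CE c e (suc j) (v< (suc j)))))
  ∷ []
  where
  via-A : ∀ {P : Fin 5 → Set} {x} → P A → ∀ j → Linked P (ladder (suc j)) x 1 → ReachesRim P (suc j) x
  via-A a j x≈ = _ , A , a , here refl , x≈
  via-B : ∀ {P : Fin 5 → Set} {x} → P B → ∀ j → Linked P (ladder (suc j)) x 0 → ReachesRim P (suc j) x
  via-B b j x≈ = _ , B , b , there (here refl) , x≈
  via-D : ∀ {P : Fin 5 → Set} {x} → P D → ∀ j → Linked P (ladder (suc j)) x (u (suc j)) → ReachesRim P (suc j) x
  via-D d j x≈ = _ , D , d , there (there (here refl)) , x≈
  via-E : ∀ {P : Fin 5 → Set} {x} → P E → ∀ j → Linked P (ladder (suc j)) x (v (suc j)) → ReachesRim P (suc j) x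
  via-E e j x≈ = _ , E , e , there (there (there (here refl))) , x≈
  -- With two rungs v₀ = 1 is not the last v, so it is not the isolated node under A and E. The same
  -- holds for u₀ = 0 under B and D in `1≈0`.
  0≈1 : ∀ {P : Fin 5 → Set} → P A → P E → ∀ j → Linked P (ladder (suc j)) 0 1
  0≈1 a e j with ladder-AE a e (suc j) {1} (s≤s (s≤s z≤n))
  ... | inj₁ 1≈0 = Linked-sym 1≈0
  1≈0 : ∀ {P : Fin 5 → Set} → P B → P D → ∀ j → Linked P (ladder (suc j)) 1 0
  1≈0 b d j with ladder-BD b d (suc j) {0} (s≤s z≤n)
  ... | inj₁ 0≈1 = Linked-sym 0≈1

-- C stands second in every pair containing it, so the first color always has an edge at the
-- additional node.
first-color-at-apex : All (λ (a , b) → ∃[ h ] (h , a) ∈ᴸ apex × h < 4) color-pairs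
first-color-at-apex = A′ ∷ A′ ∷ A′ ∷ B′ ∷ B′ ∷ D′ ∷ A′ ∷ B′ ∷ D′ ∷ E′ ∷ []
  where
  A′ : ∃[ h ] (h , A) ∈ᴸ apex × h < 4
  A′ = 0 , here refl , s≤s z≤n
  B′ : ∃[ h ] (h , B) ∈ᴸ apex × h < 4
  B′ = 1 , there (here refl) , s≤s (s≤s z≤n)
  D′ : ∃[ h ] (h , D) ∈ᴸ apex × h < 4
  D′ = 2 , there (there (here refl)) , s≤s (s≤s (s≤s z≤n))
  E′ : ∃[ h ] (h , E) ∈ᴸ apex × h < 4
  E′ = 3 , there (there (there (here refl))) , ≤-refl

-- A finite check: the decision procedure runs through all subsets of the five colors and finds no
-- counterexample.
two-colors-remain : ∀ (S : Subset 5) → ∣ S ∣ ≡ 3 → Any (λ (a , b) → a ∉ S × b ∉ S) color-pairs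
two-colors-remain S ∣S∣≡3 = decidable-stable (remain? S) λ ¬remain → exceptions (S , ∣S∣≡3 , ¬remain)
  where
  remain? : ∀ S → Dec (Any (λ (a , b) → a ∉ S × b ∉ S) color-pairs)
  remain? S = Any.any? (λ (a , b) → ¬? (a ∈? S) ×-dec ¬? (b ∈? S)) color-pairs
  exceptions : ¬ (∃[ S ] ∣ S ∣ ≡ 3 × ¬ Any (λ (a , b) → a ∉ S × b ∉ S) color-pairs)
  exceptions = toWitnessFalse {a? = anySubset? λ S → (∣ S ∣ ≟ 3) ×-dec ¬? (remain? S)} _

odd-spanning : ∀ j (S : Subset 5) → ∣ S ∣ ≡ 3 → Spanning (_∉ S) (v (2 + j)) (odd (suc j))
odd-spanning j S ∣S∣≡3
  with reach , a∉S , b∉S ← All.lookupAny ladder-reaches-rim (two-colors-remain S ∣S∣≡3) =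
  fan-spanning (rim (suc j)) (reach a∉S b∉S j)

-- The graph `odd` is already spanned by the remaining colors, so a single permitted edge at the new
-- node suffices for all x.
even-spanning : ∀ j (S : Subset 5) → ∣ S ∣ ≡ 3 → Spanning (_∉ S) (u (3 + j)) (even (suc j))
even-spanning j S ∣S∣≡3
  with (h , ha∈ , h<4) , a∉S , _ ← All.lookupAny first-color-at-apex (two-colors-remain S ∣S∣≡3) =
  fan-spanning apex λ x< → h , _ , a∉S , ha∈ , odd-spanning j S ∣S∣≡3 x<
    (≤-trans h<4 (s≤s (s≤s (s≤s (s≤s z≤n)))))

odd-colors : ∀ j a → ∃[ e ] (e , a) ∈ᴸ odd (suc j)
odd-colors j A = _ , here refl
odd-colors j B = _ , there (here refl)
odd-colors j C = _ , there (there (there (there (there (there (here refl))))))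
odd-colors j D = _ , there (there (here refl))
odd-colors j E = _ , there (there (there (here refl)))

even-colors : ∀ j a → ∃[ e ] (e , a) ∈ᴸ even (suc j)
even-colors j a with e , e∈ ← odd-colors j a = e , there (there (there (there e∈)))

-- Edge counts, parity of n and conclusion

length-ladder : ∀ j → length (ladder j) ≡ 1 + 5 * j
length-ladder zero    = refl
length-ladder (suc j) = trans (cong (5 +_) (length-ladder j)) (lem j)
  where
  lem : ∀ j → 5 + (1 + 5 * j) ≡ 1 + 5 * suc j
  lem = solve-∀

length-odd : ∀ j → length (odd (suc j)) ≡ 5 * (2 + j)
length-odd j = trans (cong (4 +_) (length-ladder (suc j))) (lem j)
  where
  lem : ∀ j → 4 + (1 + 5 * suc j) ≡ 5 * (2 + j)
  lem = solve-∀

1+length-even : ∀ j → 1 + length (even (suc j)) ≡ 5 * (3 + j)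
1+length-even j = trans (cong (5 +_) (length-odd j)) (lem j)
  where
  lem : ∀ j → 5 + 5 * (2 + j) ≡ 5 * (3 + j)
  lem = solve-∀

u≡2* : ∀ j → u j ≡ 2 * j
u≡2* zero    = refl
u≡2* (suc j) = trans (cong (2 +_) (u≡2* j)) (sym (*-suc 2 j))

-- Two rungs and w make 5 nodes, the additional node makes 6; each further rung adds two.
odd-or-even : ∀ n → 5 ≤ n → ∃[ j ] (n ≡ v (2 + j) ⊎ n ≡ u (3 + j))
odd-or-even 5                           _                   = 0 , inj₁ refl
odd-or-even 6                           _                   = 0 , inj₂ refl
odd-or-even (suc (suc n@(suc (suc (suc (suc (suc _))))))) _
  with j , n≡ ← odd-or-even n (s≤s (s≤s (s≤s (s≤s (s≤s z≤n))))) =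
  suc j , Sum.map (cong (2 +_)) (cong (2 +_)) n≡
odd-or-even 1 (s≤s ())
odd-or-even 2 (s≤s (s≤s ()))
odd-or-even 3 (s≤s (s≤s (s≤s ())))
odd-or-even 4 (s≤s (s≤s (s≤s (s≤s ()))))

≤-length-complete : ∀ n {ℓ} → ℓ ≤ (n * (n ∸ 1)) / 2 → ℓ ≤ length (complete n)
≤-length-complete n ℓ≤ = ≤-trans ℓ≤
  (≤-reflexive (trans (cong (_/ 2) (sym (length-complete n))) (m*n/n≡m (length (complete n)) 2)))

-- Cancel n in 4n ≤ 2ℓ ≤ n (n - 1).
nodes≥5 : ∀ n {ℓ} → n > 0 → ℓ ≤ length (complete n) → 2 * ℓ ≥ 4 * n → 5 ≤ n
nodes≥5 n@(suc m) {ℓ} _ ℓ≤ 4n≤2ℓ = s≤s (*-cancelˡ-≤ n (begin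
  n * 4                    ≡⟨ *-comm n 4 ⟩
  4 * n                    ≤⟨ 4n≤2ℓ ⟩
  2 * ℓ                    ≤⟨ *-monoʳ-≤ 2 ℓ≤ ⟩
  2 * length (complete n)  ≡⟨ *-comm 2 (length (complete n)) ⟩
  length (complete n) * 2  ≡⟨ length-complete n ⟩
  n * m                    ∎))
  where open ≤-Reasoning

-- The common core of (a) and (b): the bounds on ℓ are exactly the edge counts of `odd` and `even`,
-- and padding supplies the remaining edges.
colored-graph-exists : ∀ n ℓ → n > 0 → ℓ ≤ (n * (n ∸ 1)) / 2 → 2 * ℓ ≥ 4 * n →
  (∀ k → k > 0 → n ≡ 2 * k → 5 * k ≤ suc ℓ) →
  (∀ k → k > 0 → n ≡ 2 * k + 1 → 5 * k ≤ ℓ) →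
  Σ[ G ∈ ColoredEdgeGraph n ℓ 5 ] [ 3 +1]-ColorConnected G
colored-graph-exists n ℓ n>0 ℓ≤half 4n≤2ℓ even-bound odd-bound
  with ℓ≤ ← ≤-length-complete n ℓ≤half with odd-or-even n (nodes≥5 n n>0 ℓ≤ 4n≤2ℓ)
... | j , inj₁ refl = padded-graph (odd (suc j)) (odd-simple j) (odd-colors j) (odd-spanning j)
  (≤-trans (≤-reflexive (length-odd j)) (odd-bound (2 + j) (s≤s z≤n)
    (trans (cong suc (u≡2* (2 + j))) (+-comm 1 (2 * (2 + j)))))) ℓ≤
... | j , inj₂ refl = padded-graph (even (suc j)) (even-simple j) (even-colors j) (even-spanning j)
  (s≤s⁻¹ (≤-trans (≤-reflexive (1+length-even j)) (even-bound (3 + j) (s≤s z≤n) (u≡2* (3 + j))))) ℓ≤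

theorem5p7 : (n ℓ : ℕ) → n > 0 → ℓ > 0 → 5 ≤ ℓ → ℓ ≤ (n * (n ∸ 1)) / 2 →
    (μ ℓ 5 3 ≥ n ∸ 1 → 2 * ℓ ≥ 4 * n →
    Σ[ G ∈ ColoredEdgeGraph n ℓ 5 ] [ 3 +1]-ColorConnected G)
    ×
    (2 * ℓ ≥ 4 * n →
    ((k : ℕ) → k > 0 → n ≡ 2 * k → ℓ ≥ 5 * k ∸ 1) →
    ((k : ℕ) → k > 0 → n ≡ 2 * k + 1 → ℓ ≥ 5 * k) →
    Σ[ G ∈ ColoredEdgeGraph n ℓ 5 ] [ 3 +1]-ColorConnected G)
theorem5p7 n ℓ n>0 _ _ ℓ≤half =
  (λ n∸1≤μ 4n≤2ℓ → colored-graph-exists n ℓ n>0 ℓ≤half 4n≤2ℓ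
    -- For n = 2k the hypothesis gives only 2k - 1 ≤ μ; the missing unit is the slack r = 1, which
    -- reappears in 5k ≤ ℓ + 1.
    (λ { k k>0 refl → subst (5 * k ≤_) (+-comm ℓ 1) (μ-5-3-bound ℓ ≤-refl k>0
           (subst (2 * k ≤_) (+-comm 1 (μ ℓ 5 3)) (≤-trans (m≤n+m∸n (2 * k) 1) (s≤s n∸1≤μ)))) })
    (λ { k k>0 refl → subst (5 * k ≤_) (+-identityʳ ℓ) (μ-5-3-bound ℓ z≤n k>0
           (m≤n⇒m≤n+o 0 (subst (_≤ μ ℓ 5 3) (m+n∸n≡m (2 * k) 1) n∸1≤μ))) }))
  , λ 4n≤2ℓ even-bound odd-bound → colored-graph-exists n ℓ n>0 ℓ≤half 4n≤2ℓ
      (λ k k>0 n≡2k → ≤-trans (m≤n+m∸n (5 * k) 1) (s≤s (even-bound k k>0 n≡2k))) odd-bound
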